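{- Let $G$ be a connected graph of order $n$. If $\sigma_2(G)\ge n-k+1$ for some positive integer $k$, then $G$ has a spanning tree with at most $(k-1)/2$ branch vertices.
   Context: All graphs are finite, undirected, without loops or multiple edges. For a graph $G$, $\sigma_2(G)$ denotes the minimum of $d_G(u)+d_G(v)$ over all pairs of distinct nonadjacent vertices $u,v$ of $G$; if $G$ has no two nonadjacent vertices (i.e. $G$ is complete), $\sigma_2(G)=+\infty$. A branch vertex of a tree $T$ is a vertex of degree at least three in $T$. -}

module Defs where

open import Data.Nat using (ℕ; zero; suc; _+_; _*_; _≤_; _≥_)
open import Data.Bool using (Bool; true; false)
open import Data.Fin using (Fin)
open import Data.List using (List; []; _∷_; length)
open import Data.List.Relation.Unary.Unique.Propositional using (Unique)
open import Data.Fin.Properties using (_≟_)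
open import Data.Nat.Properties using (_≤?_)
open import Data.Vec using (count; allFin)
open import Relation.Binary.PropositionalEquality using (_≡_)
open import Relation.Nullary using (¬_)
open import Relation.Nullary.Decidable using (Dec; yes; no)
open import Data.Product using (Σ; ∃; _×_)
open import Data.Empty using (⊥)
import Data.Integer as ℤ

record Graph (n : ℕ) : Set where
  field
    adj   : Fin n → Fin n → Bool
    sym   : ∀ u v → adj u v ≡ adj v u
    irrefl : ∀ u → adj u u ≡ false
open Graph public

Adj : ∀ {n} → Graph n → Fin n → Fin n → Set
Adj G u v = adj G u v ≡ true

adj-dec : ∀ {n} (G : Graph n) (u v : Fin n) → Dec (Adj G u v)
adj-dec G u v with adj G u v
... | true  = yes _≡_.refl
... | false = no (λ ())

degree : ∀ {n} → Graph n → Fin n → ℕ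
degree {n} G u = count (adj-dec G u) (allFin n)

data Walk {n : ℕ} (G : Graph n) : Fin n → Fin n → Set where
  here : ∀ {u} → Walk G u u
  step : ∀ {u w v} → Adj G u w → Walk G w v → Walk G u v

Connected : ∀ {n} → Graph n → Set
Connected G = ∀ u v → Walk G u v

PathFrom : ∀ {n} → Graph n → Fin n → List (Fin n) → Fin n → Set
PathFrom G x []       last = x ≡ last
PathFrom G x (y ∷ ys) last = Adj G x y × PathFrom G y ys last

Cycle : ∀ {n} → Graph n → Set
Cycle {n} G = Σ (Fin n) λ x → Σ (List (Fin n)) λ ys → Σ (Fin n) λ z →
  Unique (x ∷ ys) × 2 ≤ length ys × PathFrom G x ys z × Adj G z x

Acyclic : ∀ {n} → Graph n → Set
Acyclic G = ¬ Cycle G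

IsTree : ∀ {n} → Graph n → Set
IsTree T = Connected T × Acyclic T

SpanningSubgraph : ∀ {n} → Graph n → Graph n → Set
SpanningSubgraph T G = ∀ u v → Adj T u v → Adj G u v

SpanningTree : ∀ {n} → Graph n → Graph n → Set
SpanningTree T G = SpanningSubgraph T G × IsTree T

branchCount : ∀ {n} → Graph n → ℕ
branchCount {n} T = count (λ v → 3 ≤? degree T v) (allFin n)

-- σ₂(G) ≥ m : every pair of distinct nonadjacent vertices has degree sum ≥ m
-- (vacuous when G is complete, matching σ₂ = +∞)
σ₂≥ : ∀ {n} → Graph n → ℤ.ℤ → Set
σ₂≥ G m = ∀ u v → ¬ (u ≡ v) → ¬ Adj G u v → m ℤ.≤ ℤ.+ (degree G u + degree G v)

{-# OPTIONS --safe #-}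

-- Take a spanning tree T with the fewest branch vertices b and, subject to that, the fewest leaves ℓ,
-- and suppose b ≥ 1.  No two leaves are adjacent in G.  Root T at a leaf x: if v is a neighbour of x in
-- G, the parent of v has degree 2 (or is x) and is not a neighbour of any other leaf y, for otherwise
-- T - v par(v) + xv would lead to a better tree.  Hence the parents of N(x) number d(x) and are disjoint
-- from N(y), from the branch vertices and from the leaves other than x.  Finally y can be chosen, on a
-- pendant path at an end branch vertex s, so that s is its only possible branch neighbour: otherwise
-- pendant paths can be moved away from s until it is no longer a branch vertex.  Thus
-- d(x) + d(y) + (ℓ - 1) + (b - 1) ≤ n, and ℓ ≥ b + 2 gives d(x) + d(y) ≤ n - 2b.
--
-- Optimality is not assumed but obtained by descent on (b , ℓ), so "contradiction" becomes a
-- continuation into the desired result R.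
module Submission where

open import Defs
open import Data.Nat using (ℕ; _+_; _*_; _≤_)
open import Data.Integer using (+_) renaming (_+_ to _+ℤ_; _-_ to _-ℤ_)
open import Data.Product using (Σ; _×_)

open import Algebra.Properties.Semiring.Sum using ()
open import Data.Bool using (Bool; true; false; if_then_else_)
open import Data.Bool.Properties using (∨-comm)
open import Data.Empty using (⊥; ⊥-elim)
open import Data.Fin using (Fin; zero; suc)
open import Data.Fin.Properties using (_≟_; any?)
import Data.Integer as ℤ
import Data.Integer.Properties as ℤ
open import Data.Integer.Tactic.RingSolver using () renaming (solve-∀ to ℤ-solve-∀)
open import Data.List using ([]; _∷_)
open import Data.List.Relation.Unary.All using (All; []; _∷_)
open import Data.List.Relation.Unary.AllPairs using ([]; _∷_)
open import Data.List.Relation.Unary.Unique.Propositional using (Unique)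
open import Data.Nat using (zero; suc; _<_; _≤?_; z≤n; s≤s; s≤s⁻¹)
open import Data.Nat.Properties hiding (_≟_; _≤?_)
open import Data.Nat.Properties using () renaming (_≟_ to _≟ℕ_)
open import Data.Nat.Tactic.RingSolver using (solve-∀)
open import Data.Product using (∃; _,_; proj₁; proj₂)
open import Data.Sum using (_⊎_; inj₁; inj₂; [_,_]′)
open import Data.Vec using (count; tabulate)
open import Function using (_∘_; id)
open import Relation.Binary.Construct.Closure.ReflexiveTransitive using (Star; ε; _◅_; _◅◅_; reverse; _⋆) renaming (map to Star-map)
open import Relation.Binary.PropositionalEquality using (_≡_; _≢_; refl; cong; cong₂; trans; subst; module ≡-Reasoning) renaming (sym to ≡-sym)
open import Relation.Nullary using (¬_; Dec; yes; no; does; contradiction)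
open import Relation.Nullary.Decidable using (¬?; _×-dec_; _⊎-dec_)

open Algebra.Properties.Semiring.Sum +-*-semiring using (sum; sum-cong-≗; sum-replicate-zero; ∑-distrib-+; ∑-comm)

private variable
  n : ℕ
  A B : Set

-- Indicators and finite sums

𝟙 : Dec A → ℕ
𝟙 d = if does d then 1 else 0

𝟙-yes : (d : Dec A) → A → 𝟙 d ≡ 1
𝟙-yes (yes _) _ = refl
𝟙-yes (no ¬a) a = contradiction a ¬a

𝟙-no : (d : Dec A) → ¬ A → 𝟙 d ≡ 0
𝟙-no (yes a) ¬a = contradiction a ¬a
𝟙-no (no _)  _  = refl

𝟙≤1 : (d : Dec A) → 𝟙 d ≤ 1
𝟙≤1 (yes _) = s≤s z≤n
𝟙≤1 (no _)  = z≤n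

𝟙-mono : (d : Dec A) (e : Dec B) → (A → B) → 𝟙 d ≤ 𝟙 e
𝟙-mono (yes a) e f = ≤-reflexive (≡-sym (𝟙-yes e (f a)))
𝟙-mono (no _)  e f = z≤n

∑-mono : {f g : Fin n → ℕ} → (∀ i → f i ≤ g i) → sum f ≤ sum g
∑-mono {zero}  f≤g = z≤n
∑-mono {suc n} f≤g = +-mono-≤ (f≤g zero) (∑-mono (f≤g ∘ suc))

-- A strict inequality at one index would make the whole sum strictly smaller, so domination without
-- loss in the total is equality throughout.
∑-mono-tight : {f g : Fin n → ℕ} → (∀ i → f i ≤ g i) → sum g ≤ sum f → ∀ i → g i ≤ f i
∑-mono-tight {suc n} {f} {g} f≤g ∑g≤∑f zero = +-cancelʳ-≤ (sum (g ∘ suc)) _ _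
  (≤-trans ∑g≤∑f (+-monoʳ-≤ (f zero) (∑-mono (f≤g ∘ suc))))
∑-mono-tight {suc n} {f} {g} f≤g ∑g≤∑f (suc i) = ∑-mono-tight (f≤g ∘ suc)
  (+-cancelˡ-≤ (g zero) _ _ (≤-trans ∑g≤∑f (+-monoˡ-≤ (sum (f ∘ suc)) (f≤g zero)))) i

≤-∑ : (f : Fin n → ℕ) (i : Fin n) → f i ≤ sum f
≤-∑ f zero    = m≤m+n _ _
≤-∑ f (suc i) = ≤-trans (≤-∑ (f ∘ suc) i) (m≤n+m _ _)

∑-1 : ∀ n → sum {n} (λ _ → 1) ≡ n
∑-1 zero    = refl
∑-1 (suc n) = cong suc (∑-1 n)

∑-zero : (f : Fin n → ℕ) → (∀ i → f i ≡ 0) → sum f ≡ 0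
∑-zero {n} f f≡0 = trans (sum-cong-≗ f≡0) (sum-replicate-zero n)

δ : Fin n → Fin n → ℕ
δ u v = 𝟙 (u ≟ v)

∑-δ : (b : Fin n) → sum (λ v → δ v b) ≡ 1
∑-δ {suc n} zero    = cong suc (∑-zero {n} (λ v → δ (suc v) zero) (λ _ → refl))
∑-δ {suc n} (suc b) = ∑-δ b

∑-+-δ : (f : Fin n → ℕ) (b : Fin n) → sum (λ v → f v + δ v b) ≡ sum f + 1
∑-+-δ f b = trans (∑-distrib-+ f (λ v → δ v b)) (cong (λ t → sum f + t) (∑-δ b))

count-tabulate : ∀ {a} {X : Set a} {P : X → Set} (P? : ∀ x → Dec (P x)) (f : Fin n → X) →
  count P? (tabulate f) ≡ sum (λ i → 𝟙 (P? (f i)))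
count-tabulate {zero}  P? f = refl
count-tabulate {suc n} P? f with does (P? (f zero))
... | true  = cong suc (count-tabulate P? (f ∘ suc))
... | false = count-tabulate P? (f ∘ suc)

degree-∑ : (G : Graph n) (u : Fin n) → degree G u ≡ sum (λ v → 𝟙 (adj-dec G u v))
degree-∑ G u = count-tabulate (adj-dec G u) id

-- Each climb raises the value of `f`, and no value exceeds `sum f`, so the fuel `suc (sum f)`
-- cannot run out.
maximal : {P : Fin n → Set} → (∀ v → Dec (P v)) → (f : Fin n → ℕ) → ∃ P →
  ∃ λ s → P s × (∀ v → P v → f v ≤ f s)
maximal {n} {P} P? f (s , ps) = climb (suc (sum f)) s ps (m≤n+m _ _)
  where
  climb : ∀ fuel s → P s → suc (sum f) ≤ f s + fuel → ∃ λ s → P s × (∀ v → P v → f v ≤ f s)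
  climb zero s ps bound = contradiction (≤-trans bound (≤-reflexive (+-identityʳ _))) (≤⇒≯ (≤-∑ f s))
  climb (suc fuel) s ps bound with any? (λ v → P? v ×-dec (suc (f s) ≤? f v))
  ... | yes (v , pv , fs<fv) = climb fuel v pv
        (≤-trans bound (≤-trans (≤-reflexive (+-suc (f s) fuel)) (+-monoˡ-≤ fuel fs<fv)))
  ... | no none = s , ps , λ v pv → ≮⇒≥ (λ lt → none (v , pv , lt))

least : {P : ℕ → Set} → (∀ k → Dec (P k)) → ∀ k → P k → ∃ λ m → P m × (∀ j → P j → m ≤ j)
least P? zero p = zero , p , λ _ _ → z≤n
least P? (suc k) p with P? zero
... | yes p₀ = zero , p₀ , λ _ _ → z≤n
... | no ¬p₀ with least (P? ∘ suc) k p
...   | m , pm , min = suc m , pm , λ where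
        zero    p₀ → contradiction p₀ ¬p₀
        (suc j) pj → s≤s (min j pj)

-- Rooted structure

Adj-sym : (H : Graph n) {u v : Fin n} → Adj H u v → Adj H v u
Adj-sym H {u} {v} uv = trans (sym H v u) uv

Adj-irrefl : (H : Graph n) {u v : Fin n} → Adj H u v → u ≢ v
Adj-irrefl H {u} uv refl with trans (≡-sym uv) (irrefl H u)
... | ()

Conn : Graph n → Set
Conn H = ∀ u v → Star (Adj H) u v

-- A spanning tree of `H` directed towards `r`; the strict decrease of `depth` rules out cycles of
-- parents. The value `par r` is arbitrary, so `Up` excludes the root.
record Rooting (H : Graph n) (r : Fin n) : Set where
  field
    par       : Fin n → Fin n
    depth     : Fin n → ℕ
    par-adj   : ∀ {v} → v ≢ r → Adj H v (par v)
    par-depth : ∀ {v} → v ≢ r → depth (par v) < depth v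

  Up : Fin n → Fin n → Set
  Up v u = v ≢ r × par v ≡ u

  abstract
    up? : ∀ v u → Dec (Up v u)
    up? v u = ¬? (v ≟ r) ×-dec (par v ≟ u)

  Up-adj : ∀ {v u} → Up v u → Adj H v u
  Up-adj (v≢r , refl) = par-adj v≢r

  Up-depth : ∀ {v u} → Up v u → depth u < depth v
  Up-depth (v≢r , refl) = par-depth v≢r

  ∑-up : ∀ v → sum (λ u → 𝟙 (up? v u)) + δ v r ≡ 1
  ∑-up v with v ≟ r
  ... | yes v≡r = cong (λ t → t + 1) (∑-zero (λ u → 𝟙 (up? v u)) λ u → 𝟙-no (up? v u) λ (v≢r , _) → v≢r v≡r)
  ... | no v≢r  = trans (+-identityʳ _) (trans (sum-cong-≗ λ u → is-par u (u ≟ par v)) (∑-δ (par v)))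
    where
    is-par : ∀ u (d : Dec (u ≡ par v)) → 𝟙 (up? v u) ≡ 𝟙 d
    is-par u (yes eq) = 𝟙-yes (up? v u) (v≢r , ≡-sym eq)
    is-par u (no neq) = 𝟙-no (up? v u) λ (_ , eq) → neq (≡-sym eq)

  ∑∑-up : sum (λ v → sum (λ u → 𝟙 (up? v u))) + 1 ≡ n
  ∑∑-up = trans (≡-sym (∑-+-δ (λ v → sum (λ u → 𝟙 (up? v u))) r)) (trans (sum-cong-≗ ∑-up) (∑-1 n))

  up-or-down : Fin n → Fin n → ℕ
  up-or-down u v = 𝟙 (up? u v) + 𝟙 (up? v u)

  -- Handshake count: each of the n - 1 parent edges is seen from both of its ends. Adding 2 on the
  -- left avoids subtraction.
  ∑∑-up-or-down : 2 + sum (λ u → sum (up-or-down u)) ≡ n + n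
  ∑∑-up-or-down = begin
    2 + sum (λ u → sum (up-or-down u))
      ≡⟨ cong (λ t → 2 + t) (sum-cong-≗ λ u → ∑-distrib-+ (λ v → 𝟙 (up? u v)) (λ v → 𝟙 (up? v u))) ⟩
    2 + sum (λ u → sum (λ v → 𝟙 (up? u v)) + sum (λ v → 𝟙 (up? v u)))
      ≡⟨ cong (λ t → 2 + t) (∑-distrib-+ (λ u → sum (λ v → 𝟙 (up? u v))) (λ u → sum (λ v → 𝟙 (up? v u)))) ⟩
    2 + (S + sum (λ u → sum (λ v → 𝟙 (up? v u))))
      ≡⟨ cong (λ t → 2 + (S + t)) (∑-comm (λ u v → 𝟙 (up? v u))) ⟩
    2 + (S + S)
      ≡⟨ double S ⟩
    (S + 1) + (S + 1)
      ≡⟨ cong₂ _+_ ∑∑-up ∑∑-up ⟩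
    n + n ∎
    where
    open ≡-Reasoning
    S = sum (λ v → sum (λ u → 𝟙 (up? v u)))
    double : ∀ s → 2 + (s + s) ≡ (s + 1) + (s + 1)
    double = solve-∀

  up-or-down≤1 : ∀ u v → up-or-down u v ≤ 1
  up-or-down≤1 u v with up? u v
  ... | no _  = 𝟙≤1 (up? v u)
  ... | yes p = s≤s (≤-reflexive (𝟙-no (up? v u) λ q → <-asym (Up-depth p) (Up-depth q)))

  up-or-down≤adj : ∀ u v → up-or-down u v ≤ 𝟙 (adj-dec H u v)
  up-or-down≤adj u v with adj-dec H u v
  ... | yes _ = up-or-down≤1 u v
  ... | no ¬a = ≤-reflexive (cong₂ _+_ (𝟙-no (up? u v) (¬a ∘ Up-adj)) (𝟙-no (up? v u) (¬a ∘ Adj-sym H ∘ Up-adj)))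

  data Desc (s : Fin n) : Fin n → Set where
    child : ∀ {v} → Up v s → Desc s v
    below : ∀ {v u} → Up v u → Desc s u → Desc s v

  Desc-depth : ∀ {s v} → Desc s v → depth s < depth v
  Desc-depth (child p)   = Up-depth p
  Desc-depth (below p d) = <-trans (Desc-depth d) (Up-depth p)

module _ (H : Graph n) (conn : Conn H) (r : Fin n) where

  private
    Reach : ℕ → Fin n → Set
    Reach zero    v = v ≡ r
    Reach (suc k) v = ∃ λ u → Adj H v u × Reach k u

    reach? : ∀ k v → Dec (Reach k v)
    reach? zero    v = v ≟ r
    reach? (suc k) v = any? (λ u → adj-dec H v u ×-dec reach? k u)

    reach : ∀ {v} → Star (Adj H) v r → ∃ λ k → Reach k v
    reach ε = zero , refl
    reach (vu ◅ w) = let k , p = reach w in suc k , _ , vu , p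

    dist : ∀ v → ∃ λ m → Reach m v × (∀ j → Reach j v → m ≤ j)
    dist v = let k , p = reach (conn v r) in least (λ j → reach? j v) k p

    nearer : ∀ v → v ≢ r → ∃ λ u → Adj H v u × proj₁ (dist u) < proj₁ (dist v)
    nearer v v≢r with dist v
    ... | zero , v≡r , _ = contradiction v≡r v≢r
    ... | suc m , (u , vu , p) , _ = u , vu , s≤s (proj₂ (proj₂ (dist u)) m p)

    parent : Fin n → Fin n
    parent v with v ≟ r
    ... | yes _ = v
    ... | no v≢r = proj₁ (nearer v v≢r)

    parent-spec : ∀ v → v ≢ r → Adj H v (parent v) × proj₁ (dist (parent v)) < proj₁ (dist v)
    parent-spec v v≢r with v ≟ r
    ... | yes v≡r = contradiction v≡r v≢r
    ... | no v≢r′ = proj₂ (nearer v v≢r′)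

  -- Breadth-first rooting: depth is the distance to `r`, and the parent is the second vertex of a
  -- shortest walk to `r`.
  rooting : Rooting H r
  rooting = record
    { par = parent ; depth = λ v → proj₁ (dist v)
    ; par-adj = λ {v} v≢r → proj₁ (parent-spec v v≢r)
    ; par-depth = λ {v} v≢r → proj₂ (parent-spec v v≢r) }

-- Trees as connected graphs with few edges

-- The degree sum is twice the number of edges, so `edges` allows at most n - 1 of them. In this
-- form a tree is easy to follow through an exchange of edges; acyclicity is derived afterwards.
record Tree (T : Graph n) : Set where
  field
    conn  : Conn T
    edges : 2 + sum (degree T) ≤ n + n

  rootAt : ∀ r → Rooting T r
  rootAt = rooting T conn

open Tree

-- The n - 1 parent edges already exhaust the edge budget of a tree.
up-or-down-adj : {T : Graph n} → Tree T → ∀ {r} (ρ : Rooting T r) → let open Rooting ρ in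
  ∀ {u v} → Adj T u v → Up u v ⊎ Up v u
up-or-down-adj {n} {T} tree ρ {u} {v} uv with up? u v | up? v u | tight
  where
  open Rooting ρ
  budget : sum (λ u → sum (λ v → 𝟙 (adj-dec T u v))) ≤ sum (λ u → sum (up-or-down u))
  budget = +-cancelˡ-≤ 2 _ _ (≤-trans
    (≤-reflexive (cong (λ t → 2 + t) (sum-cong-≗ (λ u → ≡-sym (degree-∑ T u)))))
    (≤-trans (edges tree) (≤-reflexive (≡-sym ∑∑-up-or-down))))
  tight : 1 ≤ up-or-down u v
  tight = ≤-trans (≤-reflexive (≡-sym (𝟙-yes (adj-dec T u v) uv)))
    (∑-mono-tight (up-or-down≤adj u)
      (∑-mono-tight (λ u → ∑-mono (up-or-down≤adj u)) budget u) v)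
... | yes p | _     | _ = inj₁ p
... | no _  | yes q | _ = inj₂ q

Conn⇒Connected : {T : Graph n} → Conn T → Connected T
Conn⇒Connected {T = T} conn u v = go (conn u v)
  where
  go : ∀ {u v} → Star (Adj T) u v → Walk T u v
  go ε = here
  go (e ◅ w) = step e (go w)

Connected⇒Conn : {T : Graph n} → Connected T → Conn T
Connected⇒Conn {T = T} conn u v = go (conn u v)
  where
  go : ∀ {u v} → Walk T u v → Star (Adj T) u v
  go here = ε
  go (step e w) = e ◅ go w

-- Rooting at the first vertex of a cycle, each later vertex must be a child of its predecessor.
Tree⇒Acyclic : {T : Graph n} → Tree T → Acyclic T
Tree⇒Acyclic {n} {T} tree (x , _ ∷ [] , _ , _ , s≤s () , _)
Tree⇒Acyclic {n} {T} tree
  (x , y₁ ∷ y₂ ∷ ys , z , ((x≢y₁ ∷ x≢y₂ ∷ x∉) ∷ (y₁≢y₂ ∷ y₁∉) ∷ uniq) , _ , (xy₁ , y₁y₂ , path) , zx) =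
  chain y₁ y₂ ys y₂↑y₁ (x≢y₁ ∘ ≡-sym) y₁∉ (x≢y₂ ∷ x∉) uniq path
  where
  ρ = rootAt tree x
  open Rooting ρ

  root-edge : ∀ {v} → Adj T v x → Up v x
  root-edge vx with up-or-down-adj tree ρ vx
  ... | inj₁ p = p
  ... | inj₂ (x≢x , _) = contradiction refl x≢x

  continue : ∀ {p c y} → Up c p → p ≢ y → Adj T c y → Up y c
  continue (_ , c↑p) p≢y cy with up-or-down-adj tree ρ cy
  ... | inj₁ (_ , c↑y) = contradiction (trans (≡-sym c↑p) c↑y) p≢y
  ... | inj₂ q = q

  y₂↑y₁ : Up y₂ y₁
  y₂↑y₁ = continue (root-edge (Adj-sym T xy₁)) x≢y₂ y₁y₂

  chain : ∀ p c ys → Up c p → p ≢ x → All (p ≢_) ys → All (x ≢_) (c ∷ ys) → Unique (c ∷ ys) →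
    PathFrom T c ys z → ⊥
  -- The closing edge makes the last vertex a child of `x`, whereas its parent is `p`.
  chain p c [] (_ , c↑p) p≢x _ _ _ refl = p≢x (trans (≡-sym c↑p) (proj₂ (root-edge zx)))
  chain p c (y ∷ ys) up p≢x (p≢y ∷ _) (x≢c ∷ x∉) (c∉ ∷ uniq) (cy , path) with c∉
  ... | _ ∷ c∉ys = chain c y ys (continue up p≢y cy) (x≢c ∘ ≡-sym) c∉ys x∉ uniq path

-- The parent edges of a breadth-first rooting: following parents reaches the root, and the
-- handshake count bounds the degree sum.
spanningTree : (G : Graph n) → Conn G → Fin n →
  Σ (Graph n) λ T → Tree T × SpanningSubgraph T G
spanningTree {n} G connG r = T , record { conn = conn-T ; edges = edges-T } , T⊆G
  where
  open Rooting (rooting G connG r)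

  up⊎down? : ∀ u v → Dec (Up u v ⊎ Up v u)
  up⊎down? u v = up? u v ⊎-dec up? v u

  T : Graph n
  T = record
    { adj = λ u v → does (up⊎down? u v)
    ; sym = λ u v → ∨-comm (does (up? u v)) (does (up? v u))
    ; irrefl = λ u → no-loop u (up⊎down? u u) }
    where
    no-loop : ∀ u (d : Dec (Up u u ⊎ Up u u)) → does d ≡ false
    no-loop u (no _) = refl
    no-loop u (yes (inj₁ p)) = contradiction (Up-depth p) (<-irrefl refl)
    no-loop u (yes (inj₂ p)) = contradiction (Up-depth p) (<-irrefl refl)

  T-adj : ∀ {u v} → Adj T u v → Up u v ⊎ Up v u
  T-adj {u} {v} uv with up? u v | up? v u | uv
  ... | yes p | _     | _ = inj₁ p
  ... | no _  | yes q | _ = inj₂ q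

  adj-T : ∀ {u v} → Up u v → Adj T u v
  adj-T {u} {v} p with up? u v
  ... | yes _ = refl
  ... | no ¬p = contradiction p ¬p

  T⊆G : SpanningSubgraph T G
  T⊆G u v uv = [ Up-adj , Adj-sym G ∘ Up-adj ]′ (T-adj uv)

  ascend : ∀ k v → depth v < k → Star (Adj T) v r
  ascend (suc k) v lt with v ≟ r
  ... | yes refl = ε
  ... | no v≢r = adj-T (v≢r , refl) ◅ ascend k (par v) (≤-trans (par-depth v≢r) (s≤s⁻¹ lt))

  conn-T : Conn T
  conn-T u v = ascend _ u ≤-refl ◅◅ reverse (Adj-sym T) (ascend _ v ≤-refl)

  degree-T : ∀ u → degree T u ≤ sum (up-or-down u)
  degree-T u = ≤-trans (≤-reflexive (degree-∑ T u)) (∑-mono bound)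
    where
    bound : ∀ v → 𝟙 (adj-dec T u v) ≤ up-or-down u v
    bound v with adj-dec T u v
    ... | no _ = z≤n
    ... | yes uv with T-adj uv
    ...   | inj₁ p = ≤-trans (≤-reflexive (≡-sym (𝟙-yes (up? u v) p))) (m≤m+n _ _)
    ...   | inj₂ p = ≤-trans (≤-reflexive (≡-sym (𝟙-yes (up? v u) p))) (m≤n+m _ _)

  edges-T : 2 + sum (degree T) ≤ n + n
  edges-T = ≤-trans (+-monoʳ-≤ 2 (∑-mono degree-T)) (≤-reflexive ∑∑-up-or-down)

-- Edge exchange

Edge : Fin n → Fin n → Fin n → Fin n → Set
Edge a b u v = (u ≡ a × v ≡ b) ⊎ (u ≡ b × v ≡ a)

Edge-sym : ∀ {a b u v : Fin n} → Edge a b u v → Edge a b v u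
Edge-sym (inj₁ (p , q)) = inj₂ (q , p)
Edge-sym (inj₂ (p , q)) = inj₁ (q , p)

abstract
  edge? : (a b u v : Fin n) → Dec (Edge a b u v)
  edge? a b u v = ((u ≟ a) ×-dec (v ≟ b)) ⊎-dec ((u ≟ b) ×-dec (v ≟ a))

δ-refl : (u : Fin n) → δ u u ≡ 1
δ-refl u = 𝟙-yes (u ≟ u) refl

δ-≢ : {u v : Fin n} → u ≢ v → δ u v ≡ 0
δ-≢ {u = u} {v} = 𝟙-no (u ≟ v)

𝟙-cong : (d : Dec A) (e : Dec B) → (A → B) → (B → A) → 𝟙 d ≡ 𝟙 e
𝟙-cong d e f g = ≤-antisym (𝟙-mono d e f) (𝟙-mono e d g)

∑-edge : {a b : Fin n} → a ≢ b → ∀ u → sum (λ v → 𝟙 (edge? a b u v)) ≡ δ u a + δ u b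
∑-edge {a = a} {b} a≢b u with u ≟ a | u ≟ b
... | yes refl | yes refl = contradiction refl a≢b
... | yes refl | no a≢b′ = trans (sum-cong-≗ λ v → 𝟙-cong (edge? a b a v) (v ≟ b)
        (λ { (inj₁ (_ , q)) → q ; (inj₂ (p , _)) → contradiction p a≢b }) (λ q → inj₁ (refl , q))) (∑-δ b)
... | no _ | yes refl = trans (sum-cong-≗ λ v → 𝟙-cong (edge? a b b v) (v ≟ a)
        (λ { (inj₁ (p , _)) → contradiction (≡-sym p) a≢b ; (inj₂ (_ , q)) → q }) (λ q → inj₂ (refl , q))) (∑-δ a)
... | no u≢a | no u≢b = ∑-zero (λ v → 𝟙 (edge? a b u v)) λ v → 𝟙-no (edge? a b u v)
        λ { (inj₁ (p , _)) → u≢a p ; (inj₂ (p , _)) → u≢b p }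

Minus : Graph n → Fin n → Fin n → Fin n → Fin n → Set
Minus T c d u v = Adj T u v × ¬ Edge c d u v

Avoid : Graph n → Fin n → Fin n → Fin n → Set
Avoid T y u v = Adj T u v × u ≢ y × v ≢ y

Avoid-sym : (T : Graph n) {y u v : Fin n} → Avoid T y u v → Avoid T y v u
Avoid-sym T (uv , u≢y , v≢y) = Adj-sym T uv , v≢y , u≢y

Minus-sym : (T : Graph n) {c d u v : Fin n} → Minus T c d u v → Minus T c d v u
Minus-sym T (uv , ¬e) = Adj-sym T uv , ¬e ∘ Edge-sym

Avoid⇒Minusʳ : (T : Graph n) {c d u v : Fin n} → Avoid T d u v → Minus T c d u v
Avoid⇒Minusʳ _ (uv , u≢d , v≢d) = uv , λ { (inj₁ (_ , q)) → v≢d q ; (inj₂ (p , _)) → u≢d p }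

Avoid⇒Minusˡ : (T : Graph n) {c d u v : Fin n} → Avoid T c u v → Minus T c d u v
Avoid⇒Minusˡ _ (uv , u≢c , v≢c) = uv , λ { (inj₁ (p , _)) → u≢c p ; (inj₂ (_ , q)) → v≢c q }

private
  override : Dec A → Dec B → Bool → Bool
  override (yes _) _       _ = true
  override (no _)  (yes _) _ = false
  override (no _)  (no _)  t = t

  override-cong : {A A′ B B′ : Set} (d : Dec A) (d′ : Dec A′) (e : Dec B) (e′ : Dec B′) →
    (A → A′) → (A′ → A) → (B → B′) → (B′ → B) → ∀ {t t′} → t ≡ t′ → override d e t ≡ override d′ e′ t′
  override-cong (yes _) (yes _) _ _ _ _ _ _ _ = refl
  override-cong (yes a) (no ¬a) _ _ f _ _ _ _ = contradiction (f a) ¬a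
  override-cong (no ¬a) (yes a) _ _ _ g _ _ _ = contradiction (g a) ¬a
  override-cong (no _) (no _) (yes _) (yes _) _ _ _ _ _ = refl
  override-cong (no _) (no _) (yes b) (no ¬b) _ _ f _ _ = contradiction (f b) ¬b
  override-cong (no _) (no _) (no ¬b) (yes b) _ _ _ g _ = contradiction (g b) ¬b
  override-cong (no _) (no _) (no _) (no _) _ _ _ _ eq = eq

-- The graph T - cd + ab.
module Exchange (T : Graph n) (c d a b : Fin n) (cd : Adj T c d) (¬ab : ¬ Adj T a b) (a≢b : a ≢ b) where

  exchange : Graph n
  exchange = record
    { adj = λ u v → override (edge? a b u v) (edge? c d u v) (adj T u v)
    ; sym = λ u v → override-cong (edge? a b u v) (edge? a b v u) (edge? c d u v) (edge? c d v u)
        Edge-sym Edge-sym Edge-sym Edge-sym (sym T u v)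
    ; irrefl = λ u → no-loop u (edge? a b u u) (edge? c d u u) }
    where
    no-loop : ∀ u (p : Dec (Edge a b u u)) (q : Dec (Edge c d u u)) → override p q (adj T u u) ≡ false
    no-loop u (yes (inj₁ (refl , e))) _ = contradiction e a≢b
    no-loop u (yes (inj₂ (refl , e))) _ = contradiction (≡-sym e) a≢b
    no-loop u (no _) (yes _) = refl
    no-loop u (no _) (no _)  = irrefl T u

  keep : ∀ {u v} → Minus T c d u v → Adj exchange u v
  keep {u} {v} (uv , ¬e) with edge? a b u v | edge? c d u v
  ... | yes _ | _     = refl
  ... | no _  | yes e = contradiction e ¬e
  ... | no _  | no _  = uv

  new : Adj exchange a b
  new with edge? a b a b
  ... | yes _ = refl
  ... | no ¬e = contradiction (inj₁ (refl , refl)) ¬e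

  old : ∀ {u v} → Adj exchange u v → Edge a b u v ⊎ Minus T c d u v
  old {u} {v} uv with edge? a b u v | edge? c d u v
  ... | yes e | _    = inj₁ e
  ... | no _  | no ¬e = inj₂ (uv , ¬e)

  -- As cd is an edge of `T` and ab is not, deletion and insertion shift the degrees of their ends
  -- by exactly one. The deleted edge is added on the left to avoid subtraction.
  degree-exchange : ∀ u → degree exchange u + (δ u c + δ u d) ≡ degree T u + (δ u a + δ u b)
  degree-exchange u = begin
    degree exchange u + (δ u c + δ u d)
      ≡⟨ cong₂ _+_ (degree-∑ exchange u) (≡-sym (∑-edge (Adj-irrefl T cd) u)) ⟩
    sum (λ v → 𝟙 (adj-dec exchange u v)) + sum (λ v → 𝟙 (edge? c d u v))
      ≡⟨ ∑-distrib-+ (λ v → 𝟙 (adj-dec exchange u v)) (λ v → 𝟙 (edge? c d u v)) ⟨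
    sum (λ v → 𝟙 (adj-dec exchange u v) + 𝟙 (edge? c d u v))
      ≡⟨ sum-cong-≗ (λ v → pointwise v (edge? a b u v) (edge? c d u v)) ⟩
    sum (λ v → 𝟙 (adj-dec T u v) + 𝟙 (edge? a b u v))
      ≡⟨ ∑-distrib-+ (λ v → 𝟙 (adj-dec T u v)) (λ v → 𝟙 (edge? a b u v)) ⟩
    sum (λ v → 𝟙 (adj-dec T u v)) + sum (λ v → 𝟙 (edge? a b u v))
      ≡⟨ cong₂ _+_ (≡-sym (degree-∑ T u)) (∑-edge a≢b u) ⟩
    degree T u + (δ u a + δ u b) ∎
    where
    open ≡-Reasoning
    Edge⇒Adj : ∀ {v} → Edge c d u v → Adj T u v
    Edge⇒Adj (inj₁ (refl , refl)) = cd
    Edge⇒Adj (inj₂ (refl , refl)) = Adj-sym T cd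
    ¬Edge : ∀ {v} → Edge a b u v → ¬ Adj T u v
    ¬Edge (inj₁ (refl , refl)) = ¬ab
    ¬Edge (inj₂ (refl , refl)) = ¬ab ∘ Adj-sym T
    new-edge : ∀ {v} → Edge a b u v → Adj exchange u v
    new-edge (inj₁ (refl , refl)) = new
    new-edge (inj₂ (refl , refl)) = Adj-sym exchange new
    pointwise : ∀ v (p : Dec (Edge a b u v)) (q : Dec (Edge c d u v)) →
      𝟙 (adj-dec exchange u v) + 𝟙 q ≡ 𝟙 (adj-dec T u v) + 𝟙 p
    pointwise v (yes p) (yes q) = contradiction (Edge⇒Adj q) (¬Edge p)
    pointwise v (yes p) (no _) = trans (+-identityʳ _) (trans (𝟙-yes (adj-dec exchange u v) (new-edge p))
            (cong (λ t → t + 1) (≡-sym (𝟙-no (adj-dec T u v) (¬Edge p)))))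
    pointwise v (no ¬p) (yes q) = trans (cong (λ t → t + 1) (𝟙-no (adj-dec exchange u v)
            (λ uv → [ ¬p , (λ m → proj₂ m q) ]′ (old uv))))
            (trans (≡-sym (𝟙-yes (adj-dec T u v) (Edge⇒Adj q))) (≡-sym (+-identityʳ _)))
    pointwise v (no ¬p) (no ¬q) = cong (λ t → t + 0) (𝟙-cong (adj-dec exchange u v) (adj-dec T u v)
            (λ uv → [ (λ p → contradiction p ¬p) , proj₁ ]′ (old uv)) (λ uv → keep (uv , ¬q)))

  -- The detour from `c` to `a`, across the new edge to `b` and on to `d`, replaces the lost edge cd
  -- in every walk; the degree sum is unchanged.
  exchange-tree : Tree T → Star (Minus T c d) c a → Star (Minus T c d) d b → Tree exchange
  exchange-tree tree ca db = record { conn = λ u v → (reroute ⋆) (conn tree u v) ; edges = budget }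
    where
    detour : Star (Adj exchange) c d
    detour = Star-map keep ca ◅◅ (new ◅ Star-map keep (reverse (Minus-sym T) db))
    reroute : ∀ {u v} → Adj T u v → Star (Adj exchange) u v
    reroute {u} {v} uv with edge? c d u v
    ... | yes (inj₁ (refl , refl)) = detour
    ... | yes (inj₂ (refl , refl)) = reverse (Adj-sym exchange) detour
    ... | no ¬e = keep (uv , ¬e) ◅ ε
    ∑-shift : ∀ (f : Fin n → ℕ) p q → sum (λ u → f u + (δ u p + δ u q)) ≡ sum f + 2
    ∑-shift f p q = trans (∑-distrib-+ f (λ u → δ u p + δ u q))
      (cong (λ t → sum f + t) (trans (∑-+-δ (λ u → δ u p) q) (cong (λ t → t + 1) (∑-δ p))))
    budget : 2 + sum (degree exchange) ≤ n + n
    budget = ≤-trans (≤-reflexive (cong (λ t → 2 + t) (+-cancelʳ-≡ 2 _ _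
      (trans (≡-sym (∑-shift (degree exchange) c d)) (trans (sum-cong-≗ degree-exchange) (∑-shift (degree T) a b))))))
      (edges tree)

  exchange-⊆ : ∀ G → SpanningSubgraph T G → Adj G a b → SpanningSubgraph exchange G
  exchange-⊆ G T⊆G ab u v uv with old uv
  ... | inj₁ (inj₁ (refl , refl)) = ab
  ... | inj₁ (inj₂ (refl , refl)) = Adj-sym G ab
  ... | inj₂ (uv′ , _) = T⊆G u v uv′

-- Degree sequences

numBranch numLeaf : (Fin n → ℕ) → ℕ
numBranch f = sum (λ v → 𝟙 (3 ≤? f v))
numLeaf f = sum (λ v → 𝟙 (f v ≟ℕ 1))

numBranch-mono : {f f′ : Fin n → ℕ} → (∀ w → 3 ≤ f′ w → 3 ≤ f w) → numBranch f′ ≤ numBranch f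
numBranch-mono {f = f} {f′} mono = ∑-mono λ w → 𝟙-mono (3 ≤? f′ w) (3 ≤? f w) (mono w)

numBranch-strict : {f f′ : Fin n → ℕ} (s : Fin n) → (∀ w → 3 ≤ f′ w → 3 ≤ f w) → 3 ≤ f s → ¬ 3 ≤ f′ s →
  numBranch f′ < numBranch f
numBranch-strict {f = f} {f′} s mono fs ¬f′s = ≤-trans
  (≤-reflexive (trans (+-comm 1 _) (≡-sym (∑-+-δ (λ w → 𝟙 (3 ≤? f′ w)) s)))) (∑-mono λ w → bound w (w ≟ s))
  where
  bound : ∀ w (d : Dec (w ≡ s)) → 𝟙 (3 ≤? f′ w) + 𝟙 d ≤ 𝟙 (3 ≤? f w)
  bound w (yes refl) = ≤-reflexive (trans (cong (λ t → t + 1) (𝟙-no (3 ≤? f′ s) ¬f′s)) (≡-sym (𝟙-yes (3 ≤? f s) fs)))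
  bound w (no _) = ≤-trans (≤-reflexive (+-identityʳ _)) (𝟙-mono (3 ≤? f′ w) (3 ≤? f w) (mono w))

-- The leaf `x` is traded for at most one new leaf `u`. Adding the indicator of `x` on one side and
-- of `u` on the other makes the comparison hold termwise, also when `x` and `u` coincide.
numLeaf-replace : {f f′ : Fin n → ℕ} (x u : Fin n) → f x ≡ 1 → (f′ x ≡ 1 → x ≡ u) →
  (∀ w → w ≢ x → w ≢ u → f′ w ≡ 1 → f w ≡ 1) → numLeaf f′ ≤ numLeaf f
numLeaf-replace {f = f} {f′} x u fx f′x other = +-cancelʳ-≤ 1 _ _ (≤-trans
  (≤-reflexive (≡-sym (∑-+-δ (λ w → 𝟙 (f′ w ≟ℕ 1)) x)))
  (≤-trans (∑-mono λ w → bound w (w ≟ x) (w ≟ u)) (≤-reflexive (∑-+-δ (λ w → 𝟙 (f w ≟ℕ 1)) u))))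
  where
  bound : ∀ w (d : Dec (w ≡ x)) (e : Dec (w ≡ u)) → 𝟙 (f′ w ≟ℕ 1) + 𝟙 d ≤ 𝟙 (f w ≟ℕ 1) + 𝟙 e
  bound w (yes refl) (yes _)  = +-monoˡ-≤ 1 (𝟙-mono (f′ w ≟ℕ 1) (f w ≟ℕ 1) λ _ → fx)
  bound w (yes refl) (no x≢u) = ≤-trans (≤-reflexive (cong (λ t → t + 1) (𝟙-no (f′ w ≟ℕ 1) (x≢u ∘ f′x))))
    (≤-trans (≤-reflexive (≡-sym (𝟙-yes (f w ≟ℕ 1) fx))) (m≤m+n _ 0))
  bound w (no _) (yes _) = ≤-trans (≤-reflexive (+-identityʳ _)) (≤-trans (𝟙≤1 (f′ w ≟ℕ 1)) (m≤n+m 1 _))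
  bound w (no w≢x) (no w≢u) = +-monoˡ-≤ 0 (𝟙-mono (f′ w ≟ℕ 1) (f w ≟ℕ 1) (other w w≢x w≢u))

numLeaf-strict : {f f′ : Fin n → ℕ} (x : Fin n) → f x ≡ 1 → f′ x ≢ 1 →
  (∀ w → w ≢ x → f′ w ≡ 1 → f w ≡ 1) → numLeaf f′ < numLeaf f
numLeaf-strict {f = f} {f′} x fx f′x other = ≤-trans
  (≤-reflexive (trans (+-comm 1 _) (≡-sym (∑-+-δ (λ w → 𝟙 (f′ w ≟ℕ 1)) x)))) (∑-mono λ w → bound w (w ≟ x))
  where
  bound : ∀ w (d : Dec (w ≡ x)) → 𝟙 (f′ w ≟ℕ 1) + 𝟙 d ≤ 𝟙 (f w ≟ℕ 1)
  bound w (yes refl) = ≤-reflexive (trans (cong (λ t → t + 1) (𝟙-no (f′ w ≟ℕ 1) f′x)) (≡-sym (𝟙-yes (f w ≟ℕ 1) fx)))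
  bound w (no w≢x) = ≤-trans (≤-reflexive (+-identityʳ _)) (𝟙-mono (f′ w ≟ℕ 1) (f w ≟ℕ 1) (other w w≢x))

-- Leaves, and walks avoiding a vertex

two-neighbours : (T : Graph n) {y u w : Fin n} → Adj T y u → Adj T y w → u ≢ w → 2 ≤ degree T y
two-neighbours T {y} {u} {w} yu yw u≢w = ≤-trans
  (≤-reflexive (≡-sym (trans (∑-+-δ (λ v → δ v u) w) (cong (λ t → t + 1) (∑-δ u)))))
  (≤-trans (∑-mono λ v → bound v (v ≟ u) (v ≟ w)) (≤-reflexive (≡-sym (degree-∑ T y))))
  where
  bound : ∀ v (d : Dec (v ≡ u)) (e : Dec (v ≡ w)) → 𝟙 d + 𝟙 e ≤ 𝟙 (adj-dec T y v)
  bound v (yes refl) (yes refl) = contradiction refl u≢w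
  bound v (yes refl) (no _)     = ≤-reflexive (≡-sym (𝟙-yes (adj-dec T y v) yu))
  bound v (no _)     (yes refl) = ≤-reflexive (≡-sym (𝟙-yes (adj-dec T y v) yw))
  bound v (no _)     (no _)     = z≤n

leaf-neighbour : (T : Graph n) {y u w : Fin n} → degree T y ≡ 1 → Adj T y u → Adj T y w → u ≡ w
leaf-neighbour T {y} {u} {w} leaf yu yw with u ≟ w
... | yes u≡w = u≡w
... | no u≢w = contradiction (≤-trans (two-neighbours T yu yw u≢w) (≤-reflexive leaf)) (<-irrefl refl)

leaf≢branch : (T : Graph n) {x s : Fin n} → degree T x ≡ 1 → 3 ≤ degree T s → x ≢ s
leaf≢branch T leaf branch refl with subst (3 ≤_) leaf branch
... | s≤s ()

len : {R : Fin n → Fin n → Set} {p q : Fin n} → Star R p q → ℕ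
len ε       = 0
len (_ ◅ w) = suc (len w)

len-map : {R S : Fin n → Fin n → Set} (f : ∀ {u v} → R u v → S u v) {p q : Fin n} (w : Star R p q) →
  len (Star-map f w) ≡ len w
len-map f ε       = refl
len-map f (_ ◅ w) = cong suc (len-map f w)

Avoid-start : (T : Graph n) {y q : Fin n} → Star (Avoid T y) y q → y ≡ q
Avoid-start _ ε = refl
Avoid-start _ ((_ , y≢y , _) ◅ _) = contradiction refl y≢y

-- The walk is cut at its last visit to `y`; what follows starts at a neighbour of `y` and is
-- shorter.
last-exit : (T : Graph n) (y : Fin n) {p q : Fin n} → q ≢ y → (w : Star (Adj T) p q) →
  (Σ (Star (Avoid T y) p q) λ w′ → len w′ ≤ len w) ⊎
  (Σ (Fin n) λ u → Adj T y u × Σ (Star (Avoid T y) u q) λ w′ → len w′ < len w)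
last-exit T y q≢y ε = inj₁ (ε , z≤n)
last-exit T y {p} q≢y (_◅_ {j = p₁} e w) with last-exit T y q≢y w
... | inj₂ (u , yu , w′ , le) = inj₂ (u , yu , w′ , m≤n⇒m≤1+n le)
... | inj₁ (w′ , le) with p ≟ y | p₁ ≟ y
...   | yes refl | _        = inj₂ (p₁ , e , w′ , s≤s le)
...   | no _     | yes refl = contradiction (≡-sym (Avoid-start T w′)) q≢y
...   | no p≢y   | no p₁≢y  = inj₁ ((e , p≢y , p₁≢y) ◅ w′ , s≤s le)

exit : (T : Graph n) {y q : Fin n} → y ≢ q → (w : Star (Adj T) y q) →
  Σ (Fin n) λ u → Adj T y u × Σ (Star (Avoid T y) u q) λ w′ → len w′ < len w
exit T {y} y≢q w with last-exit T y (y≢q ∘ ≡-sym) w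
... | inj₁ (w′ , _) = contradiction (Avoid-start T w′) y≢q
... | inj₂ r = r

-- Deleting a leaf does not disconnect: a walk that visits `y` leaves it for the last time through
-- its only neighbour `u`.
leaf-bypass : (T : Graph n) → Conn T → {y u q : Fin n} → degree T y ≡ 1 → Adj T y u → q ≢ y → Star (Avoid T y) u q
leaf-bypass T conn {y} {u} {q} leaf yu q≢y with last-exit T y q≢y (conn u q)
... | inj₁ (w , _) = w
... | inj₂ (u′ , yu′ , w , _) with leaf-neighbour T leaf yu yu′
...   | refl = w

-- Counting leaves against branch vertices

Adj⇒1≤degree : (T : Graph n) {v u : Fin n} → Adj T v u → 1 ≤ degree T v
Adj⇒1≤degree T {v} {u} vu = ≤-trans (≤-reflexive (≡-sym (𝟙-yes (adj-dec T v u) vu)))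
  (≤-trans (≤-∑ (λ w → 𝟙 (adj-dec T v w)) u) (≤-reflexive (≡-sym (degree-∑ T v))))

∑-suc : (f : Fin n → ℕ) → sum (λ v → 1 + f v) ≡ n + sum f
∑-suc {n} f = trans (∑-distrib-+ (λ _ → 1) f) (cong (λ t → t + sum f) (∑-1 n))

-- Every degree m ≥ 1 satisfies 2 + [m ≥ 3] ≤ m + [m = 1]. Summed over all vertices and compared
-- with the degree sum, at most 2n - 2, this leaves the claim. The vertex `s` serves to show that
-- all degrees are positive.
branch+2≤leaf : {T : Graph n} → Tree T → {s : Fin n} → 3 ≤ degree T s →
  numBranch (degree T) + 2 ≤ numLeaf (degree T)
branch+2≤leaf {n} {T} tree {s} branch = +-cancelʳ-≤ (sum f) _ _ (+-cancelˡ-≤ (n + n) _ _ (begin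
  (n + n) + (numBranch f + 2 + sum f)     ≡⟨ rearrange n (numBranch f) (sum f) ⟩
  (n + (n + numBranch f)) + (2 + sum f)   ≤⟨ +-mono-≤ total (edges tree) ⟩
  (sum f + numLeaf f) + (n + n)           ≡⟨ +-comm _ (n + n) ⟩
  (n + n) + (sum f + numLeaf f)           ≡⟨ cong (λ t → (n + n) + t) (+-comm (sum f) _) ⟩
  (n + n) + (numLeaf f + sum f)           ∎))
  where
  open ≤-Reasoning
  f = degree T
  rearrange : ∀ n b t → (n + n) + (b + 2 + t) ≡ (n + (n + b)) + (2 + t)
  rearrange = solve-∀
  positive : ∀ v → 1 ≤ f v
  positive v with v ≟ s | conn tree v s
  ... | yes refl | _       = ≤-trans (s≤s z≤n) branch
  ... | no v≢s   | ε       = contradiction refl v≢s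
  ... | no _     | vu ◅ _  = Adj⇒1≤degree T vu
  pointwise : ∀ m → 1 ≤ m → 1 + (1 + 𝟙 (3 ≤? m)) ≤ m + 𝟙 (m ≟ℕ 1)
  pointwise 1 _ = ≤-refl
  pointwise 2 _ = ≤-refl
  pointwise (suc (suc (suc m))) _ = s≤s (s≤s (s≤s z≤n))
  total : n + (n + numBranch f) ≤ sum f + numLeaf f
  total = begin
    n + (n + numBranch f)                     ≡⟨ cong (λ t → n + t) (∑-suc (λ v → 𝟙 (3 ≤? f v))) ⟨
    n + sum (λ v → 1 + 𝟙 (3 ≤? f v))          ≡⟨ ∑-suc (λ v → 1 + 𝟙 (3 ≤? f v)) ⟨
    sum (λ v → 1 + (1 + 𝟙 (3 ≤? f v)))        ≤⟨ ∑-mono (λ v → pointwise (f v) (positive v)) ⟩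
    sum (λ v → f v + 𝟙 (f v ≟ℕ 1))            ≡⟨ ∑-distrib-+ f (λ v → 𝟙 (f v ≟ℕ 1)) ⟩
    sum f + numLeaf f                         ∎

-- Finite form of arguing by contradiction at each vertex: a single exception already delivers the
-- result `R`.
collect : {P : Fin n → Set} {R : Set} → (∀ u → R ⊎ P u) → R ⊎ (∀ u → P u)
collect {zero}  _ = inj₂ λ ()
collect {suc n} each with each zero | collect (each ∘ suc)
... | inj₁ r | _      = inj₁ r
... | inj₂ _ | inj₁ r = inj₁ r
... | inj₂ p | inj₂ q = inj₂ λ { zero → p ; (suc i) → q i }

-- Branches at a vertex and end branch vertices

siblings : {T : Graph n} → Tree T → {s p q : Fin n} → Adj T s p → Adj T s q → Star (Avoid T s) p q → p ≡ q
siblings {n} {T} tree {s} {p} {q} sp sq walk = conclude (preserve walk (inj₁ refl))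
  where
  ρ = rootAt tree s
  open Rooting ρ

  Below : Fin n → Set
  Below v = v ≡ p ⊎ Desc p v

  child-of-s : ∀ {v} → Adj T s v → Up v s
  child-of-s sv with up-or-down-adj tree ρ sv
  ... | inj₁ (s≢s , _) = contradiction refl s≢s
  ... | inj₂ up = up

  -- With the tree rooted at `s`, the subtree at `p` can only be left through `s`; the only
  -- neighbour of `s` in it is `p`.
  below-step : ∀ {v u} → Avoid T s v u → Below v → Below u
  below-step (vu , _ , u≢s) b with up-or-down-adj tree ρ vu
  below-step (vu , _ , u≢s) (inj₁ refl) | inj₁ (_ , v↑u) = contradiction (trans (≡-sym v↑u) (proj₂ (child-of-s sp))) u≢s
  below-step (vu , _ , u≢s) (inj₂ (child (_ , v↑p))) | inj₁ (_ , v↑u) = inj₁ (trans (≡-sym v↑u) v↑p)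
  below-step (vu , _ , u≢s) (inj₂ (below (_ , refl) d)) | inj₁ (_ , refl) = inj₂ d
  below-step (vu , _ , u≢s) (inj₁ refl) | inj₂ up = inj₂ (child up)
  below-step (vu , _ , u≢s) (inj₂ d) | inj₂ up = inj₂ (below up d)

  preserve : ∀ {v u} → Star (Avoid T s) v u → Below v → Below u
  preserve ε b = b
  preserve (e ◅ w) b = preserve w (below-step e b)

  root∉Desc : ¬ Desc p s
  root∉Desc (child (s≢s , _)) = s≢s refl
  root∉Desc (below (s≢s , _) _) = s≢s refl

  conclude : Below q → p ≡ q
  conclude (inj₁ q≡p) = ≡-sym q≡p
  conclude (inj₂ (child (_ , q↑p))) =
    contradiction (trans (≡-sym (proj₂ (child-of-s sq))) q↑p) (Adj-irrefl T sp)
  conclude (inj₂ (below (_ , q↑u) d)) =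
    contradiction (subst (Desc p) (trans (≡-sym q↑u) (proj₂ (child-of-s sq))) d) root∉Desc

-- s is an end branch vertex: all its neighbours except possibly e lead into D, which is a union of
-- pendant paths at s.
record EndBranch (T : Graph n) (s : Fin n) (D : Fin n → Set) (e : Fin n) : Set where
  field
    not-branch : ∀ {v} → D v → ¬ 3 ≤ degree T v
    s∉D        : ¬ D s
    closed     : ∀ {v w} → D v → Adj T v w → w ≢ s → D w
    enters     : ∀ {w} → Adj T s w → w ≢ e → D w

  closed* : ∀ {v w} → D v → Star (Avoid T s) v w → D w
  closed* d ε = d
  closed* d ((vw , _ , w≢s) ◅ walk) = closed* (closed d vw w≢s) walk

-- A branch vertex of greatest depth has no branch vertex among its descendants, so `D` consists of
-- its descendants and `e` is its parent.
endBranch : {T : Graph n} → Tree T → {s : Fin n} → 3 ≤ degree T s →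
  Σ (Fin n) λ s → 3 ≤ degree T s × Σ (Fin n → Set) λ D → Σ (Fin n) λ e → EndBranch T s D e
endBranch {n} {T} tree {s₀} branch₀ with maximal (λ v → 3 ≤? degree T v) (Rooting.depth (rootAt tree s₀)) (s₀ , branch₀)
... | s , branch , deepest = s , branch , Desc s , par s , record
  { not-branch = λ d b → <⇒≱ (Desc-depth d) (deepest _ b)
  ; s∉D = λ d → <-irrefl refl (Desc-depth d)
  ; closed = closed
  ; enters = enters }
  where
  ρ = rootAt tree s₀
  open Rooting ρ
  closed : ∀ {v w} → Desc s v → Adj T v w → w ≢ s → Desc s w
  closed d vw w≢s with up-or-down-adj tree ρ vw
  closed d vw w≢s | inj₂ up = below up d
  closed (child (_ , v↑s)) vw w≢s | inj₁ (_ , v↑w) = contradiction (trans (≡-sym v↑w) v↑s) w≢s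
  closed (below (_ , refl) d) vw w≢s | inj₁ (_ , refl) = d
  enters : ∀ {w} → Adj T s w → w ≢ par s → Desc s w
  enters sw w≢ with up-or-down-adj tree ρ sw
  ... | inj₁ (_ , s↑w) = contradiction (≡-sym s↑w) w≢
  ... | inj₂ up = child up

other-neighbour : (T : Graph n) (v e : Fin n) → 2 ≤ degree T v → Σ (Fin n) λ w → Adj T v w × w ≢ e
other-neighbour T v e 2≤ with any? (λ w → adj-dec T v w ×-dec ¬? (w ≟ e))
... | yes p = p
... | no none = contradiction (≤-trans 2≤ (≤-trans (≤-reflexive (degree-∑ T v))
        (≤-trans (∑-mono bound) (≤-reflexive (∑-δ e))))) (<-irrefl refl)
  where
  bound : ∀ w → 𝟙 (adj-dec T v w) ≤ δ w e
  bound w with w ≟ e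
  ... | yes _ = 𝟙≤1 (adj-dec T v w)
  ... | no w≢e = ≤-reflexive (𝟙-no (adj-dec T v w) λ vw → none (w , vw , w≢e))

other-leaf : (T : Graph n) (y : Fin n) → 2 ≤ numLeaf (degree T) → Σ (Fin n) λ x → degree T x ≡ 1 × x ≢ y
other-leaf T y 2≤ with any? (λ x → (degree T x ≟ℕ 1) ×-dec ¬? (x ≟ y))
... | yes p = p
... | no none = contradiction (≤-trans 2≤ (≤-trans (∑-mono λ x → bound x (x ≟ y)) (≤-reflexive (∑-δ y)))) (<-irrefl refl)
  where
  bound : ∀ x (d : Dec (x ≡ y)) → 𝟙 (degree T x ≟ℕ 1) ≤ 𝟙 d
  bound x (yes _) = 𝟙≤1 (degree T x ≟ℕ 1)
  bound x (no x≢y) = ≤-reflexive (𝟙-no (degree T x ≟ℕ 1) λ leaf → none (x , leaf , x≢y))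

-- Rooted at `s`, the walk from `w` keeps passing to children until a leaf is met; depth grows and
-- is bounded by `sum depth`.
leaf-beyond : {T : Graph n} → Tree T → {s w : Fin n} → Adj T s w →
  Σ (Fin n) λ y → degree T y ≡ 1 × Star (Avoid T s) y w
leaf-beyond {n} {T} tree {s} {w} sw = go (suc (sum depth)) w (Adj-irrefl T sw ∘ ≡-sym) ε (m≤n+m _ _)
  where
  ρ = rootAt tree s
  open Rooting ρ
  go : ∀ fuel v → v ≢ s → Star (Avoid T s) v w → suc (sum depth) ≤ depth v + fuel →
    Σ (Fin n) λ y → degree T y ≡ 1 × Star (Avoid T s) y w
  go zero v _ _ bound = contradiction (≤-trans bound (≤-reflexive (+-identityʳ _))) (≤⇒≯ (≤-∑ depth v))
  go (suc fuel) v v≢s walk bound with degree T v ≟ℕ 1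
  ... | yes leaf = v , leaf , walk
  ... | no ¬leaf with other-neighbour T v (par v) (≤∧≢⇒< (Adj⇒1≤degree T (par-adj v≢s)) (¬leaf ∘ ≡-sym))
  ...   | u , vu , u≢par with up-or-down-adj tree ρ vu
  ...     | inj₁ (_ , v↑u) = contradiction (≡-sym v↑u) u≢par
  ...     | inj₂ u↑v@(u≢s , _) = go fuel u u≢s ((Adj-sym T vu , u≢s , v≢s) ◅ walk)
              (≤-trans bound (≤-trans (≤-reflexive (+-suc (depth v) fuel)) (+-monoˡ-≤ fuel (Up-depth u↑v))))

-- Improving a candidate tree: R is the desired result, supplied by any better tree

module Improve (G : Graph n) {R : Set} (β μ : ℕ)
  (better : ∀ T → Tree T → SpanningSubgraph T G →
    numBranch (degree T) < β ⊎ (numBranch (degree T) ≤ β × numLeaf (degree T) < μ) → R) where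

  -- Bounds rather than equalities: an exchange raising neither count yields a candidate again, and
  -- a strict drop below a bound goes to `better`.
  record Candidate (T : Graph n) : Set where
    constructor candidate
    field
      tree     : Tree T
      sub      : SpanningSubgraph T G
      branch≤β : numBranch (degree T) ≤ β
      leaf≤μ   : numLeaf (degree T) ≤ μ

  open Candidate

  -- The outcome of an exchange that gains nothing: `u` had degree 2 and takes over from `x` as a
  -- leaf.
  record Slid (T : Graph n) (x u v : Fin n) : Set where
    field
      result    : Graph n
      cand      : Candidate result
      degree-u  : degree T u ≡ 2
      leaf-u    : degree result u ≡ 1
      unchanged : ∀ {w} → w ≢ x → w ≢ u → degree result w ≡ degree T w
      kept      : ∀ {p q} → Minus T u v p q → Adj result p q

  -- T - uv + xv
  slide : ∀ {T x u v} → Candidate T → degree T x ≡ 1 → 2 ≤ degree T u → Adj T u v → ¬ Adj T x v → x ≢ v →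
    Adj G x v → Star (Minus T u v) u x → R ⊎ Slid T x u v
  slide {T} {x} {u} {v} C leaf-x 2≤u uv ¬xv x≢v Gxv walk = cases (3 ≤? degree T u)
    where
    open Exchange T u v x v uv ¬xv x≢v
    f = degree T
    f′ = degree exchange
    u≢x : u ≢ x
    u≢x refl = ¬xv uv
    tree′ = exchange-tree (tree C) walk ε
    sub′ = exchange-⊆ G (sub C) Gxv
    -- The vertex `v` loses `u` and gains `x`, so its terms cancel.
    shift : ∀ w {p q} → δ w u ≡ p → δ w x ≡ q → f′ w + p ≡ f w + q
    shift w refl refl = +-cancelʳ-≡ (δ w v) _ _
      (trans (+-assoc (f′ w) _ _) (trans (degree-exchange w) (≡-sym (+-assoc (f w) _ _))))
    at-x : f′ x ≡ 2
    at-x = trans (≡-sym (+-identityʳ _)) (trans (shift x (δ-≢ (u≢x ∘ ≡-sym)) (δ-refl x)) (cong (λ t → t + 1) leaf-x))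
    at-u : suc (f′ u) ≡ f u
    at-u = trans (+-comm 1 _) (trans (shift u (δ-refl u) (δ-≢ u≢x)) (+-identityʳ _))
    at-other : ∀ {w} → w ≢ x → w ≢ u → f′ w ≡ f w
    at-other {w} w≢x w≢u = +-cancelʳ-≡ 0 _ _ (shift w (δ-≢ w≢u) (δ-≢ w≢x))
    branch-mono : ∀ w → 3 ≤ f′ w → 3 ≤ f w
    branch-mono w 3≤ with w ≟ x | w ≟ u
    ... | yes refl | _ = contradiction (subst (3 ≤_) at-x 3≤) λ { (s≤s (s≤s ())) }
    ... | no _ | yes refl = ≤-trans 3≤ (≤-trans (n≤1+n _) (≤-reflexive at-u))
    ... | no w≢x | no w≢u = ≤-trans 3≤ (≤-reflexive (at-other w≢x w≢u))
    x-not-leaf : f′ x ≢ 1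
    x-not-leaf eq with trans (≡-sym at-x) eq
    ... | ()
    -- If `u` has degree at least 3, it keeps degree at least 2 and no leaf replaces `x`, which is
    -- an improvement. Otherwise `u` has degree exactly 2.
    cases : Dec (3 ≤ f u) → R ⊎ Slid T x u v
    cases (yes 3≤u) = inj₁ (better exchange tree′ sub′ (inj₂
      ( ≤-trans (numBranch-mono branch-mono) (branch≤β C)
      , ≤-trans (numLeaf-strict x leaf-x x-not-leaf others) (leaf≤μ C))))
      where
      others : ∀ w → w ≢ x → f′ w ≡ 1 → f w ≡ 1
      others w w≢x leaf with w ≟ u
      ... | yes refl = contradiction (≤-trans 3≤u (≤-reflexive (trans (≡-sym at-u) (cong suc leaf)))) λ { (s≤s (s≤s ())) }
      ... | no w≢u = trans (≡-sym (at-other w≢x w≢u)) leaf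
    cases (no ¬3≤u) = inj₂ record
      { result = exchange
      ; cand = candidate tree′ sub′ (≤-trans (numBranch-mono branch-mono) (branch≤β C))
          (≤-trans (numLeaf-replace x u leaf-x (λ eq → contradiction eq x-not-leaf)
            (λ w w≢x w≢u leaf → trans (≡-sym (at-other w≢x w≢u)) leaf)) (leaf≤μ C))
      ; degree-u = u≡2
      ; leaf-u = suc-injective (trans at-u u≡2)
      ; unchanged = at-other
      ; kept = keep }
      where
      u≡2 : f u ≡ 2
      u≡2 = ≤-antisym (s≤s⁻¹ (≰⇒> ¬3≤u)) 2≤u

  -- The cycle T + xy is rotated until its missing edge meets a branch vertex.
  adjacent-leaves : ∀ {T x y s} → Candidate T → degree T x ≡ 1 → degree T y ≡ 1 → x ≢ y → Adj G x y →
    3 ≤ degree T s → R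
  adjacent-leaves {T} {x} {y} {s} C leaf-x leaf-y x≢y Gxy branch =
    rotate _ C leaf-x leaf-y x≢y Gxy branch (conn (tree C) y s) ≤-refl
    where
    rotate : ∀ fuel {T x y} → Candidate T → degree T x ≡ 1 → degree T y ≡ 1 → x ≢ y → Adj G x y →
      3 ≤ degree T s → (w : Star (Adj T) y s) → len w ≤ fuel → R
    rotate fuel {T} {x} {y} C leaf-x leaf-y x≢y Gxy branch w bound
      with exit T (leaf≢branch T leaf-y branch) w
    rotate zero C leaf-x leaf-y x≢y Gxy branch w bound | u , yu , w′ , lt = contradiction (≤-trans lt bound) λ ()
    rotate (suc fuel) {T} {x} {y} C leaf-x leaf-y x≢y Gxy branch w bound | u , yu , w′ , lt =
      continue (slide C leaf-x (2≤u w′) (Adj-sym T yu) ¬xy x≢y Gxy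
        (Star-map (Avoid⇒Minusʳ T) (leaf-bypass T (conn (tree C)) leaf-y yu x≢y)))
      where
      2≤u : Star (Avoid T y) u s → 2 ≤ degree T u
      2≤u ε = ≤-trans (n≤1+n 2) branch
      2≤u ((ut , _ , t≢y) ◅ _) = two-neighbours T ut (Adj-sym T yu) t≢y
      ¬xy : ¬ Adj T x y
      ¬xy xy with leaf-neighbour T leaf-y yu (Adj-sym T xy)
      ... | refl = contradiction (≤-trans (2≤u w′) (≤-reflexive leaf-x)) (<-irrefl refl)
      continue : R ⊎ Slid T x u y → R
      continue (inj₁ r) = r
      -- Now `y` hangs on `x`, and `y` and `u` are leaves joined in `G` by the deleted edge. The
      -- walk from `u` to the branch vertex is shorter than the one from `y`.
      continue (inj₂ S) = rotate fuel cand (trans (unchanged (x≢y ∘ ≡-sym) y≢u) leaf-y) leaf-u y≢u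
        (sub C _ _ yu) (≤-trans branch (≤-reflexive (≡-sym (unchanged (leaf≢branch T leaf-x branch ∘ ≡-sym) s≢u))))
        (Star-map (kept ∘ Avoid⇒Minusʳ T) w′)
        (≤-trans (≤-reflexive (len-map (kept ∘ Avoid⇒Minusʳ T) w′)) (s≤s⁻¹ (≤-trans lt bound)))
        where
        open Slid S
        y≢u : y ≢ u
        y≢u = Adj-irrefl T yu
        s≢u : s ≢ u
        s≢u refl = contradiction (subst (3 ≤_) degree-u branch) λ { (s≤s (s≤s ())) }

  -- Parents of the neighbours of a leaf

  module _ {T x} (C : Candidate T) (leaf-x : degree T x ≡ 1) where

    private
      ρ = rootAt (tree C) x
    open Rooting ρ

    ascend-avoiding : ∀ {v} p → depth p < depth v → Star (Avoid T v) p x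
    ascend-avoiding {v} p lt = go _ p ≤-refl lt
      where
      go : ∀ k p → depth p < k → depth p < depth v → Star (Avoid T v) p x
      go (suc k) p lt lt′ with p ≟ x
      ... | yes refl = ε
      ... | no p≢x = (par-adj p≢x , (λ { refl → <-irrefl refl lt′ }) , λ { refl → <-asym (par-depth p≢x) lt′ })
        ◅ go k (par p) (≤-trans (par-depth p≢x) (s≤s⁻¹ lt)) (<-trans (par-depth p≢x) lt′)

    -- The ascent from `u` to the root `x` stays above the depth of `v`, so it survives the deletion
    -- of uv; and xv is not a tree edge, since the parent of `v` is `u` and not `x`.
    reparent : ∀ {u v} → Adj G x v → u ≢ x → Up v u → R ⊎ Slid T x u v
    reparent {u} {v} Gxv u≢x v↑u = slide C leaf-x
      (two-neighbours T (par-adj u≢x) (Adj-sym T (Up-adj v↑u)) λ { refl → <-asym (par-depth u≢x) (Up-depth v↑u) })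
      (Adj-sym T (Up-adj v↑u)) ¬xv (Adj-irrefl G Gxv) Gxv
      (Star-map (Avoid⇒Minusʳ T) (ascend-avoiding u (Up-depth v↑u)))
      where
      ¬xv : ¬ Adj T x v
      ¬xv xv with up-or-down-adj (tree C) ρ xv
      ... | inj₁ (x≢x , _) = x≢x refl
      ... | inj₂ (_ , v↑x) = u≢x (trans (≡-sym (proj₂ v↑u)) v↑x)

    parent-not-branch : ∀ {u v} → Adj G x v → u ≢ x → Up v u → 3 ≤ degree T u → R
    parent-not-branch Gxv u≢x v↑u 3≤u with reparent Gxv u≢x v↑u
    ... | inj₁ r = r
    ... | inj₂ S = contradiction (subst (3 ≤_) (Slid.degree-u S) 3≤u) λ { (s≤s (s≤s ())) }

    -- In T - uv + xv both `u` and `y` are leaves, and they are adjacent in `G`.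
    parent-not-neighbour : ∀ {u v y s} → degree T y ≡ 1 → x ≢ y → 3 ≤ degree T s →
      Adj G x v → u ≢ x → Up v u → Adj G y u → R
    parent-not-neighbour {u} {v} {y} {s} leaf-y x≢y branch Gxv u≢x v↑u Gyu with reparent Gxv u≢x v↑u
    ... | inj₁ r = r
    ... | inj₂ S = adjacent-leaves cand (trans (unchanged (x≢y ∘ ≡-sym) y≢u) leaf-y) leaf-u y≢u Gyu
        (≤-trans branch (≤-reflexive (≡-sym (unchanged (leaf≢branch T leaf-x branch ∘ ≡-sym) s≢u))))
      where
      open Slid S
      y≢u : y ≢ u
      y≢u = Adj-irrefl G Gyu
      s≢u : s ≢ u
      s≢u refl = contradiction (subst (3 ≤_) degree-u branch) λ { (s≤s (s≤s ())) }

  -- Degree count and peeling of pendant paths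

  module Conclude (k : ℕ) (1≤k : 1 ≤ k)
    (σ : ∀ u v → u ≢ v → ¬ Adj G u v → n + 1 ≤ degree G u + degree G v + k)
    (done : ∀ T → Tree T → SpanningSubgraph T G → 2 * numBranch (degree T) + 1 ≤ k → R) where

    -- Apart from s and x, every vertex is at most one of: a parent of a neighbour of x, a neighbour of y,
    -- a leaf, a branch vertex.
    finish : ∀ {T x y s} → Candidate T → degree T x ≡ 1 → degree T y ≡ 1 → x ≢ y → 3 ≤ degree T s →
      (∀ z → 3 ≤ degree T z → z ≢ s → ¬ Adj G y z) → R
    finish {T} {x} {y} {s} C leaf-x leaf-y x≢y branch y≁ with 2 * numBranch (degree T) + 1 ≤? k | adj-dec G x y
    ... | yes small | _ = done T (tree C) (sub C) small
    ... | no _ | yes Gxy = adjacent-leaves C leaf-x leaf-y x≢y Gxy branch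
    ... | no ¬small | no ¬Gxy = [ id , (λ all → ⊥-elim (impossible all)) ]′ (collect (λ u → local u (any? (child? u)) (adj-dec G y u) (u ≟ x) (u ≟ s)))
      where
      ρ = rootAt (tree C) x
      open Rooting ρ
      f = degree T
      b = numBranch f

      abstract
        child? : ∀ u v → Dec (Up v u × Adj G x v)
        child? u v = up? v u ×-dec adj-dec G x v

      c : Fin n → ℕ
      c u = sum (λ v → 𝟙 (child? u v))

      -- Each neighbour of `x` in `G` is counted once, at its parent.
      ∑-c : degree G x ≤ sum c
      ∑-c = ≤-trans (≤-reflexive (degree-∑ G x)) (≤-trans (∑-mono at-parent)
        (≤-reflexive (∑-comm (λ v u → 𝟙 (child? u v)))))
        where
        at-parent : ∀ v → 𝟙 (adj-dec G x v) ≤ sum (λ u → 𝟙 (child? u v))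
        at-parent v = ≤-trans (𝟙-mono (adj-dec G x v) (child? (par v) v)
            (λ xv → ((λ v≡x → Adj-irrefl G xv (≡-sym v≡x)) , refl) , xv))
          (≤-∑ (λ u → 𝟙 (child? u v)) (par v))

      -- Parent and children of `u` are distinct tree neighbours; `δ u x` stands in for the missing
      -- parent of the root. Hence `c u` is at most 1 at the leaf `x` and at every vertex of degree
      -- at most 2.
      c-bound : ∀ u → c u + 1 ≤ f u + δ u x
      c-bound u = begin
        c u + 1                                         ≡⟨ cong (λ t → c u + t) (∑-up u) ⟨
        c u + (sum (λ v → 𝟙 (up? u v)) + δ u x)         ≡⟨ +-assoc (c u) _ _ ⟨
        (c u + sum (λ v → 𝟙 (up? u v))) + δ u x         ≡⟨ cong (λ t → t + δ u x) (∑-distrib-+ (λ v → 𝟙 (child? u v)) (λ v → 𝟙 (up? u v))) ⟨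
        sum (λ v → 𝟙 (child? u v) + 𝟙 (up? u v)) + δ u x ≤⟨ +-monoˡ-≤ (δ u x) (∑-mono pointwise) ⟩
        sum (λ v → 𝟙 (adj-dec T u v)) + δ u x           ≡⟨ cong (λ t → t + δ u x) (degree-∑ T u) ⟨
        f u + δ u x                                     ∎
        where
        open ≤-Reasoning
        pointwise : ∀ v → 𝟙 (child? u v) + 𝟙 (up? u v) ≤ 𝟙 (adj-dec T u v)
        pointwise v = ≤-trans (≤-reflexive (+-comm (𝟙 (child? u v)) _))
          (≤-trans (+-monoʳ-≤ (𝟙 (up? u v)) (𝟙-mono (child? u v) (up? v u) proj₁)) (up-or-down≤adj u v))

      -- The two exceptions: `x` may be both a leaf and the parent of a neighbour of its own, and
      -- `s` both a branch vertex and a neighbour of `y`.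
      Local : Fin n → Set
      Local u = (c u + 𝟙 (adj-dec G y u)) + (𝟙 (f u ≟ℕ 1) + 𝟙 (3 ≤? f u)) ≤ 1 + (δ u s + δ u x)

      leaf+branch≤1 : ∀ m → 𝟙 (m ≟ℕ 1) + 𝟙 (3 ≤? m) ≤ 1
      leaf+branch≤1 0 = z≤n
      leaf+branch≤1 1 = ≤-refl
      leaf+branch≤1 2 = z≤n
      leaf+branch≤1 (suc (suc (suc m))) = ≤-refl

      bounded : ∀ {u p q ℓ r t t′} → c u ≤ p → 𝟙 (adj-dec G y u) ≤ q → 𝟙 (f u ≟ℕ 1) ≤ ℓ → 𝟙 (3 ≤? f u) ≤ r →
        t ≤ δ u s → t′ ≤ δ u x → (p + q) + (ℓ + r) ≤ 1 + (t + t′) → Local u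
      bounded a₁ a₂ a₃ a₄ a₅ a₆ le =
        ≤-trans (+-mono-≤ (+-mono-≤ a₁ a₂) (+-mono-≤ a₃ a₄)) (≤-trans le (s≤s (+-mono-≤ a₅ a₆)))

      zero-by : {P : Set} (d : Dec P) → ¬ P → 𝟙 d ≤ 0
      zero-by d ¬p = ≤-reflexive (𝟙-no d ¬p)

      no-child : ∀ {u} → ¬ (∃ λ v → Up v u × Adj G x v) → c u ≤ 0
      no-child {u} none = ≤-reflexive (∑-zero (λ v → 𝟙 (child? u v)) λ v → 𝟙-no (child? u v) λ p → none (v , p))

      local : ∀ u → Dec (∃ λ v → Up v u × Adj G x v) → Dec (Adj G y u) → Dec (u ≡ x) → Dec (u ≡ s) → R ⊎ Local u
      local u (yes _) (yes Gyx) (yes refl) _ = contradiction (Adj-sym G Gyx) ¬Gxy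
      local u (yes _) (no ¬Gyx) (yes refl) _ = inj₂ (bounded
        (+-cancelʳ-≤ 1 _ 1 (≤-trans (c-bound x) (≤-reflexive (cong₂ _+_ leaf-x (δ-refl x)))))
        (zero-by (adj-dec G y x) ¬Gyx) (𝟙≤1 (f x ≟ℕ 1))
        (zero-by (3 ≤? f x) λ 3≤ → leaf≢branch T leaf-x 3≤ refl)
        z≤n (≤-reflexive (≡-sym (δ-refl x))) ≤-refl)
      local u (yes (v , v↑u , Gxv)) (yes Gyu) (no u≢x) _ =
        inj₁ (parent-not-neighbour C leaf-x leaf-y x≢y branch Gxv u≢x v↑u Gyu)
      local u (yes (v , v↑u , Gxv)) (no ¬Gyu) (no u≢x) _ with 3 ≤? f u
      ... | yes 3≤u = inj₁ (parent-not-branch C leaf-x Gxv u≢x v↑u 3≤u)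
      ... | no ¬3≤u = inj₂ (bounded
        (+-cancelʳ-≤ 1 _ 1 (≤-trans c+1≤f (s≤s⁻¹ (≰⇒> ¬3≤u))))
        (zero-by (adj-dec G y u) ¬Gyu) (zero-by (f u ≟ℕ 1) not-leaf) (zero-by (3 ≤? f u) ¬3≤u)
        z≤n z≤n ≤-refl)
        where
        c+1≤f : c u + 1 ≤ f u
        c+1≤f = ≤-trans (c-bound u) (≤-reflexive (trans (cong (λ t → f u + t) (δ-≢ u≢x)) (+-identityʳ _)))
        1≤c : 1 ≤ c u
        1≤c = ≤-trans (≤-reflexive (≡-sym (𝟙-yes (child? u v) (v↑u , Gxv)))) (≤-∑ (λ v → 𝟙 (child? u v)) v)
        not-leaf : f u ≢ 1
        not-leaf leaf-u = <-irrefl refl (≤-trans (+-monoˡ-≤ 1 1≤c) (≤-trans c+1≤f (≤-reflexive leaf-u)))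
      local u (no none) (no ¬Gyu) _ _ = inj₂ (≤-trans
        (+-mono-≤ (+-mono-≤ (no-child none) (zero-by (adj-dec G y u) ¬Gyu)) (leaf+branch≤1 (f u))) (m≤m+n 1 _))
      local u (no none) (yes Gyu) _ u≟s with f u ≟ℕ 1 | 3 ≤? f u | u≟s
      ... | yes leaf-u | _ | _ = inj₁ (adjacent-leaves C leaf-y leaf-u (Adj-irrefl G Gyu) Gyu branch)
      ... | no ¬leaf | yes 3≤u | no u≢s = contradiction Gyu (y≁ u 3≤u u≢s)
      ... | no ¬leaf | yes 3≤u | yes refl = inj₂ (bounded (no-child none) (𝟙≤1 (adj-dec G y u))
        (zero-by (f u ≟ℕ 1) ¬leaf) (𝟙≤1 (3 ≤? f u)) (≤-reflexive (≡-sym (δ-refl u))) z≤n ≤-refl)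
      ... | no ¬leaf | no ¬3≤u | _ = inj₂ (bounded (no-child none) (𝟙≤1 (adj-dec G y u))
        (zero-by (f u ≟ℕ 1) ¬leaf) (zero-by (3 ≤? f u) ¬3≤u) z≤n z≤n ≤-refl)

      total : (∀ u → Local u) → (degree G x + degree G y) + (numLeaf f + b) ≤ n + 2
      total all = begin
        (degree G x + degree G y) + (numLeaf f + b)
          ≤⟨ +-monoˡ-≤ (numLeaf f + b) (+-mono-≤ ∑-c (≤-reflexive (degree-∑ G y))) ⟩
        (sum c + sum (λ u → 𝟙 (adj-dec G y u))) + (numLeaf f + b)
          ≡⟨ cong₂ _+_ (∑-distrib-+ c (λ u → 𝟙 (adj-dec G y u)))
               (∑-distrib-+ (λ u → 𝟙 (f u ≟ℕ 1)) (λ u → 𝟙 (3 ≤? f u))) ⟨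
        sum (λ u → c u + 𝟙 (adj-dec G y u)) + sum (λ u → 𝟙 (f u ≟ℕ 1) + 𝟙 (3 ≤? f u))
          ≡⟨ ∑-distrib-+ (λ u → c u + 𝟙 (adj-dec G y u)) (λ u → 𝟙 (f u ≟ℕ 1) + 𝟙 (3 ≤? f u)) ⟨
        sum (λ u → (c u + 𝟙 (adj-dec G y u)) + (𝟙 (f u ≟ℕ 1) + 𝟙 (3 ≤? f u)))
          ≤⟨ ∑-mono all ⟩
        sum (λ u → 1 + (δ u s + δ u x))
          ≡⟨ ∑-suc (λ u → δ u s + δ u x) ⟩
        n + sum (λ u → δ u s + δ u x)
          ≡⟨ cong (λ t → n + t) (trans (∑-+-δ (λ u → δ u s) x) (cong (λ t → t + 1) (∑-δ s))) ⟩
        n + 2 ∎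
        where open ≤-Reasoning

      impossible : (∀ u → Local u) → ⊥
      -- The degree-sum hypothesis, ℓ ≥ b + 2 and k ≤ 2b exceed the total n + 2 by one; k ≤ 2b is
      -- the failure of 2b + 1 ≤ k.
      impossible all = <-irrefl refl (begin
        1 + (n + 2 + 2 * b)                       ≡⟨ arith₁ n b ⟩
        (n + 1) + ((b + 2) + b)                   ≤⟨ +-mono-≤ (σ x y x≢y ¬Gxy) (+-monoˡ-≤ b (branch+2≤leaf (tree C) branch)) ⟩
        (degree G x + degree G y + k) + (numLeaf f + b)  ≡⟨ arith₂ (degree G x + degree G y) k (numLeaf f + b) ⟩
        ((degree G x + degree G y) + (numLeaf f + b)) + k ≤⟨ +-mono-≤ (total all) k≤2b ⟩
        n + 2 + 2 * b                             ∎)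
        where
        open ≤-Reasoning
        k≤2b : k ≤ 2 * b
        k≤2b = s≤s⁻¹ (≤-trans (≰⇒> ¬small) (≤-reflexive (+-comm _ 1)))
        arith₁ : ∀ n b → 1 + (n + 2 + 2 * b) ≡ (n + 1) + ((b + 2) + b)
        arith₁ = solve-∀
        arith₂ : ∀ d k l → (d + k) + l ≡ (d + l) + k
        arith₂ = solve-∀

    -- A leaf y on a pendant path at s that sees another branch vertex z lets that path be moved to z,
    -- which lowers the degree of s until it stops being a branch vertex.
    peel : ∀ fuel {T s D e} → Candidate T → EndBranch T s D e → 3 ≤ degree T s → degree T s ≤ fuel → R
    peel zero C E branch bound = contradiction (≤-trans branch bound) λ ()
    peel (suc fuel) {T} {s} {D} {e} C E branch bound
      with other-neighbour T s e (≤-trans (n≤1+n 2) branch)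
    ... | y′ , sy′ , y′≢e with leaf-beyond (tree C) sy′
    ...   | y , leaf-y , yy′ with any? (λ z → (3 ≤? degree T z) ×-dec (¬? (z ≟ s) ×-dec adj-dec G y z))
    ...     | no none with other-leaf T y (≤-trans (m≤n+m 2 _) (branch+2≤leaf (tree C) branch))
    ...       | x , leaf-x , x≢y = finish C leaf-x leaf-y x≢y branch λ z 3≤z z≢s Gyz → none (z , 3≤z , z≢s , Gyz)
    peel (suc fuel) {T} {s} {D} {e} C E branch bound
      | y′ , sy′ , y′≢e | y , leaf-y , yy′ | yes (z , 3≤z , z≢s , Gyz) = continue (3 ≤? f′ s)
      where
      open EndBranch E
      y′∈D : D y′
      y′∈D = enters sy′ y′≢e
      y∈D : D y
      y∈D = closed* y′∈D (reverse (Avoid-sym T) yy′)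
      z∉D : ¬ D z
      z∉D z∈D = not-branch z∈D 3≤z
      ∈D≢ : ∀ {v w} → D v → ¬ D w → w ≢ v
      ∈D≢ d ¬d refl = ¬d d
      s≢y = ∈D≢ y∈D s∉D
      s≢y′ = ∈D≢ y′∈D s∉D
      z≢y = ∈D≢ y∈D z∉D
      z≢y′ = ∈D≢ y′∈D z∉D
      ¬zy : ¬ Adj T z y
      ¬zy zy = z∉D (closed y∈D (Adj-sym T zy) z≢s)
      -- T - sy′ + zy: the pendant path is cut off at `s` and hung on `z` by its leaf `y`.
      open Exchange T s y′ z y sy′ ¬zy z≢y
      f = degree T
      f′ = degree exchange

      -- A walk to `z` that leaves `s` for good through `y′` would stay in `D`, which contains no
      -- branch vertex.
      s⇝z : Star (Minus T s y′) s z
      s⇝z with exit T (z≢s ∘ ≡-sym) (conn (tree C) s z)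
      ... | u , su , walk , _ = (su , λ { (inj₁ (_ , refl)) → z∉D (closed* y′∈D walk) ; (inj₂ (p , _)) → s≢y′ p })
                                ◅ Star-map (Avoid⇒Minusˡ T) walk

      tree′ = exchange-tree (tree C) s⇝z (Star-map (Avoid⇒Minusˡ T) (reverse (Avoid-sym T) yy′))
      sub′ = exchange-⊆ G (sub C) (Adj-sym G Gyz)

      shift : ∀ w {p q r t} → δ w s ≡ p → δ w y′ ≡ q → δ w z ≡ r → δ w y ≡ t → f′ w + (p + q) ≡ f w + (r + t)
      shift w refl refl refl refl = degree-exchange w
      at-s : suc (f′ s) ≡ f s
      at-s = trans (+-comm 1 _) (trans (shift s (δ-refl s) (δ-≢ s≢y′) (δ-≢ (z≢s ∘ ≡-sym)) (δ-≢ s≢y)) (+-identityʳ _))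
      at-z : f′ z ≡ f z + 1
      at-z = trans (≡-sym (+-identityʳ _)) (shift z (δ-≢ z≢s) (δ-≢ z≢y′) (δ-refl z) (δ-≢ z≢y))
      at-y : y ≢ y′ → f′ y ≡ 2
      at-y y≢y′ = trans (≡-sym (+-identityʳ _)) (trans
        (shift y (δ-≢ (s≢y ∘ ≡-sym)) (δ-≢ y≢y′) (δ-≢ (z≢y ∘ ≡-sym)) (δ-refl y)) (cong (λ t → t + 1) leaf-y))
      not-gaining : ∀ {w} → w ≢ z → w ≢ y → f′ w ≤ f w
      not-gaining {w} w≢z w≢y = ≤-trans (m≤m+n _ _) (≤-reflexive (trans (shift w refl refl (δ-≢ w≢z) (δ-≢ w≢y)) (+-identityʳ _)))
      at-other : ∀ {w} → w ≢ s → w ≢ z → w ≢ y → w ≢ y′ → f′ w ≡ f w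
      at-other {w} w≢s w≢z w≢y w≢y′ = +-cancelʳ-≡ 0 _ _ (shift w (δ-≢ w≢s) (δ-≢ w≢y′) (δ-≢ w≢z) (δ-≢ w≢y))

      y-not-branch : ¬ 3 ≤ f′ y
      y-not-branch 3≤ = contradiction (≤-trans 3≤ (≤-trans (m≤m+n _ _) (≤-reflexive
        (trans (shift y refl refl (δ-≢ (z≢y ∘ ≡-sym)) (δ-refl y)) (cong (λ t → t + 1) leaf-y))))) λ { (s≤s (s≤s ())) }

      branch-mono : ∀ w → 3 ≤ f′ w → 3 ≤ f w
      branch-mono w 3≤ with w ≟ z | w ≟ y
      ... | yes refl | _ = 3≤z
      ... | no _ | yes refl = contradiction 3≤ y-not-branch
      ... | no w≢z | no w≢y = ≤-trans 3≤ (not-gaining w≢z w≢y)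

      leaf-other : ∀ w → w ≢ y → w ≢ y′ → f′ w ≡ 1 → f w ≡ 1
      leaf-other w w≢y w≢y′ leaf with w ≟ s | w ≟ z
      ... | yes refl | _ = contradiction (≤-trans branch (≤-reflexive (trans (≡-sym at-s) (cong suc leaf)))) λ { (s≤s (s≤s ())) }
      ... | no _ | yes refl = contradiction (≤-trans (≤-trans 3≤z (m≤m+n _ 1)) (≤-reflexive (trans (≡-sym at-z) leaf))) λ { (s≤s ()) }
      ... | no w≢s | no w≢z = trans (≡-sym (at-other w≢s w≢z w≢y w≢y′)) leaf

      -- If the path is the single vertex `y`, it remains a leaf; otherwise `y` rises to degree 2
      -- and `y′` may become a leaf in its place.
      leaf-y-only : f′ y ≡ 1 → y ≡ y′
      leaf-y-only leaf with y ≟ y′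
      ... | yes eq = eq
      ... | no y≢y′ = contradiction (trans (≡-sym (at-y y≢y′)) leaf) λ ()

      -- The moved path, that is everything reachable from `y` without `s`, is removed from `D`.
      D′ : Fin n → Set
      D′ v = D v × ¬ Star (Avoid T s) y v

      E′ : EndBranch exchange s D′ e
      E′ = record
        { not-branch = λ {v} (d , _) 3≤ → not-branch d (branch-mono v 3≤)
        ; s∉D = s∉D ∘ proj₁
        ; closed = closed′
        ; enters = enters′ }
        where
        closed′ : ∀ {v w} → D′ v → Adj exchange v w → w ≢ s → D′ w
        closed′ (d , ¬r) vw w≢s with old vw
        ... | inj₁ (inj₁ (refl , _)) = contradiction d z∉D
        ... | inj₁ (inj₂ (refl , _)) = contradiction ε ¬r
        ... | inj₂ (vw′ , _) = closed d vw′ w≢s , λ r →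
                ¬r (r ◅◅ ((Adj-sym T vw′ , w≢s , (λ { refl → s∉D d })) ◅ ε))
        enters′ : ∀ {w} → Adj exchange s w → w ≢ e → D′ w
        enters′ sw w≢e with old sw
        ... | inj₁ (inj₁ (s≡z , _)) = contradiction (≡-sym s≡z) z≢s
        ... | inj₁ (inj₂ (s≡y , _)) = contradiction s≡y s≢y
        -- A neighbour of `s` on the moved path must be `y′`, but the edge to `y′` was deleted.
        ... | inj₂ (sw′ , ¬e) = enters sw′ w≢e , λ r →
                ¬e (inj₁ (refl , ≡-sym (siblings (tree C) sy′ sw′ (reverse (Avoid-sym T) yy′ ◅◅ r))))

      continue : Dec (3 ≤ f′ s) → R
      continue (no ¬3≤) = better exchange tree′ sub′
        (inj₁ (≤-trans (numBranch-strict s branch-mono branch ¬3≤) (branch≤β C)))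
      continue (yes 3≤) = peel fuel
        (candidate tree′ sub′ (≤-trans (numBranch-mono branch-mono) (branch≤β C))
          (≤-trans (numLeaf-replace y y′ leaf-y leaf-y-only leaf-other) (leaf≤μ C)))
        E′ 3≤ (s≤s⁻¹ (≤-trans (≤-reflexive at-s) bound))

    improve : ∀ {T} → Candidate T → R
    improve {T} C with any? (λ v → 3 ≤? degree T v)
    ... | no none = done T (tree C) (sub C) (≤-trans (≤-reflexive (cong (λ b → 2 * b + 1)
            (∑-zero (λ v → 𝟙 (3 ≤? degree T v)) λ v → 𝟙-no (3 ≤? degree T v) λ 3≤ → none (v , 3≤)))) 1≤k)
    ... | yes (s₀ , branch₀) with endBranch (tree C) branch₀
    ...   | s , branch , D , e , E = peel _ C E branch ≤-refl

-- Lexicographic descent and the theorem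

branchCount-∑ : (T : Graph n) → branchCount T ≡ numBranch (degree T)
branchCount-∑ T = count-tabulate (λ v → 3 ≤? degree T v) id

σ₂-ℕ : ∀ n k d → (+ n) -ℤ (+ k) +ℤ (+ 1) ℤ.≤ + d → n + 1 ≤ d + k
σ₂-ℕ n k d le = ℤ.drop‿+≤+ (subst (ℤ._≤ + (d + k)) (rearrange (+ n) (+ k)) (ℤ.+-monoˡ-≤ (+ k) le))
  where
  rearrange : ∀ a b → (a -ℤ b +ℤ (+ 1)) +ℤ b ≡ a +ℤ (+ 1)
  rearrange = ℤ-solve-∀

module Descent (G : Graph n) {R : Set} (k : ℕ) (1≤k : 1 ≤ k)
  (σ : ∀ u v → u ≢ v → ¬ Adj G u v → n + 1 ≤ degree G u + degree G v + k)
  (done : ∀ T → Tree T → SpanningSubgraph T G → 2 * numBranch (degree T) + 1 ≤ k → R) where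

  -- Recursion on the pair of `β` and `μ` in lexicographic order; `improve` receives the recursive
  -- call as its means of handling a better tree.
  descent : ∀ β μ T → Tree T → SpanningSubgraph T G →
    numBranch (degree T) < β ⊎ (numBranch (degree T) ≤ β × numLeaf (degree T) < μ) → R
  descent zero zero T _ _ (inj₁ ())
  descent zero zero T _ _ (inj₂ (_ , ()))
  -- Fewer branch vertices may cost leaves, so the leaf bound is reset from the tree at hand.
  descent (suc β) zero T tree sub (inj₁ (s≤s b≤β)) = descent β (suc (numLeaf (degree T))) T tree sub (inj₂ (b≤β , ≤-refl))
  descent (suc β) zero T _ _ (inj₂ (_ , ()))
  descent β (suc μ) T tree sub (inj₁ b<β) = descent β μ T tree sub (inj₁ b<β)
  descent β (suc μ) T tree sub (inj₂ (b≤β , s≤s ℓ≤μ)) =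
    Conclude.improve k 1≤k σ done (candidate tree sub b≤β ℓ≤μ)
    where open Improve G β μ (descent β μ)

theorem2 : (n : ℕ) (G : Graph n) (k : ℕ) → 1 ≤ k → Connected G →
    σ₂≥ G ((+ n) -ℤ (+ k) +ℤ (+ 1)) →
    Σ (Graph n) λ T → SpanningTree T G × 2 * branchCount T + 1 ≤ k
-- The empty graph is its own spanning tree and offers no vertex to root at.
theorem2 zero G k 1≤k _ _ = G , ((λ _ _ uv → uv) , (λ ()) , λ { (() , _) }) , 1≤k
theorem2 n@(suc _) G k 1≤k connected σ =
  let T , tree , sub = spanningTree G (Connected⇒Conn connected) zero
  -- The initial bounds are the branch count of `T` and one more than its leaf count.
  in descent _ _ T tree sub (inj₂ (≤-refl , ≤-refl))
  where
  done : ∀ T → Tree T → SpanningSubgraph T G → 2 * numBranch (degree T) + 1 ≤ k →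
    Σ (Graph n) λ T → SpanningTree T G × 2 * branchCount T + 1 ≤ k
  done T tree sub few = T , (sub , Conn⇒Connected (conn tree) , Tree⇒Acyclic tree) ,
    subst (λ b → 2 * b + 1 ≤ k) (≡-sym (branchCount-∑ T)) few
  open Descent G k 1≤k (λ u v u≢v ¬uv → σ₂-ℕ n k _ (σ u v u≢v ¬uv)) done
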